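{- There exists an absolute constant $c>0$ such that for every power of two $n\ge 4$ there exists a connected graph $G$ on $n$ vertices with pathwidth two such that $\delta(\mathcal{A}(G))\ge c\, n\log n$.
   Context: For a connected graph $G=(V,E)$, a search tree on $G$ is a rooted tree with vertex set $V$ defined recursively: its root is some vertex $r\in V$, and $r$ is joined to the roots of search trees on each connected component of $G-r$. The tubes of a search tree are the vertex sets of its subtrees. Two search trees on $G$ are related by a rotation if their sets of tubes have symmetric difference of size exactly two. The graph associahedron $\mathcal{A}(G)$ is a polytope whose skeleton is isomorphic to the graph on search trees of $G$ with adjacency given by rotations; $\delta(\mathcal{A}(G))$ is the diameter of this graph. Pathwidth is the usual graph parameter. -}

module Defs where

open import Level using (0ℓ)
open import Data.Nat using (ℕ; zero; suc; _≤_; _<_)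
open import Data.Fin using (Fin)
open import Data.Fin.Subset using (Subset; _∈_; _∉_; ⊤; _-_; ∣_∣; Nonempty)
open import Data.List using (List; []; _∷_; _++_)
open import Data.List.Relation.Unary.All using (All)
open import Data.List.Relation.Unary.Any using (Any)
open import Data.List.Relation.Unary.AllPairs using (AllPairs)
import Data.List.Membership.Propositional as LM
open import Data.Product using (Σ; ∃; _×_; _,_)
open import Relation.Nullary using (¬_)
open import Relation.Binary.PropositionalEquality using (_≡_; _≢_)
open import Function.Bundles using (_⇔_)

_∈ˡ_ : ∀ {n} → Subset n → List (Subset n) → Set
t ∈ˡ T = LM._∈_ t T

_∉ˡ_ : ∀ {n} → Subset n → List (Subset n) → Set
t ∉ˡ T = ¬ (t ∈ˡ T)

record Graph (n : ℕ) : Set₁ where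
  field
    Adj    : Fin n → Fin n → Set
    sym    : ∀ {u v} → Adj u v → Adj v u
    irrefl : ∀ {u} → ¬ Adj u u
open Graph public

module _ {n : ℕ} (G : Graph n) where

  data Reach (S : Subset n) : Fin n → Fin n → Set where
    here  : ∀ {u} → u ∈ S → Reach S u u
    there : ∀ {u w v} → u ∈ S → Adj G u w → Reach S w v → Reach S u v

  ConnectedSet : Subset n → Set
  ConnectedSet S = Nonempty S × (∀ u v → u ∈ S → v ∈ S → Reach S u v)

  Connected : Set
  Connected = ConnectedSet ⊤

  IsComponents : Subset n → List (Subset n) → Set
  IsComponents S Cs =
    All ConnectedSet Cs ×
    (∀ v → (v ∈ S) ⇔ Any (v ∈_) Cs) ×
    AllPairs (λ C D → ∀ u v → u ∈ C → v ∈ D → (u ≢ v) × ¬ Adj G u v) Cs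

  -- IsSearchTree S T : T is the list of tubes of a search tree on G[S]
  -- (root r ∈ S, joined to search trees on the components of G[S] - r;
  -- the tubes are the vertex sets of all subtrees).
  mutual
    data IsSearchTree : Subset n → List (Subset n) → Set where
      node : ∀ {S r Cs Ts} → r ∈ S → IsComponents (S - r) Cs →
             SearchForest Cs Ts → IsSearchTree S (S ∷ Ts)

    data SearchForest : List (Subset n) → List (Subset n) → Set where
      []  : SearchForest [] []
      _∷_ : ∀ {C Cs T Ts} → IsSearchTree C T → SearchForest Cs Ts →
            SearchForest (C ∷ Cs) (T ++ Ts)

  SearchTree : List (Subset n) → Set
  SearchTree = IsSearchTree ⊤

  SameTubes : List (Subset n) → List (Subset n) → Set
  SameTubes T T' = ∀ t → (t ∈ˡ T) ⇔ (t ∈ˡ T')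

  Rotation : List (Subset n) → List (Subset n) → Set
  Rotation T T' = Σ (Subset n) λ t → Σ (Subset n) λ t' →
    t ∈ˡ T × t ∉ˡ T' × t' ∈ˡ T' × t' ∉ˡ T ×
    (∀ u → u ∈ˡ T → u ≢ t → u ∈ˡ T') ×
    (∀ u → u ∈ˡ T' → u ≢ t' → u ∈ˡ T)

  data RotWalk : List (Subset n) → List (Subset n) → ℕ → Set where
    done : ∀ {T T'} → SameTubes T T' → RotWalk T T' 0
    step : ∀ {T T' T'' ℓ} → SearchTree T' → Rotation T T' →
           RotWalk T' T'' ℓ → RotWalk T T'' (suc ℓ)

  record PathDecomposition (w : ℕ) : Set where
    field
      m          : ℕ
      bag        : Fin m → Subset n
      covers     : ∀ v → ∃ λ i → v ∈ bag i
      edges      : ∀ u v → Adj G u v → ∃ λ i → u ∈ bag i × v ∈ bag i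
      contiguous : ∀ v (i j k : Fin m) → Data.Fin.toℕ i ≤ Data.Fin.toℕ j →
                   Data.Fin.toℕ j ≤ Data.Fin.toℕ k →
                   v ∈ bag i → v ∈ bag k → v ∈ bag j
      width      : ∀ i → ∣ bag i ∣ ≤ suc w

  PathwidthTwo : Set
  PathwidthTwo = PathDecomposition 2 × ¬ PathDecomposition 1

{-# OPTIONS --safe #-}
module Submission where

-- G is the square of the path 0, 1, ..., n - 1. Fix a dyadic interval I of
-- vertices, split into two halves, and a vertex p of I. The tubes that contain p
-- form a chain; keep those with root in I and look at the pattern formed by the
-- halves of their roots. Every tube meets I in a connected set, so a rotation
-- that exchanges the roots u and v can only shorten an alternating subsequence
-- if u and v lie in different halves of I, and then by at most two; this happens
-- for at most one I. Deleting first the even vertices in bit-reversal order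
-- gives a tree whose pattern alternates completely in every I, while deleting
-- 0, 1, 2, ... gives a tree whose pattern, for p in the lower half, never reaches
-- the upper half. Summing the lengths of the alternating patterns over all I yields
-- the bound, as in Wilber's lower bound for binary search trees.

open import Defs
open import Data.Nat using (ℕ; _≤_; _*_; _^_)
open import Data.Product using (Σ; _×_)
open import Data.List using (List)
open import Data.Fin.Subset using (Subset)
open import Data.Bool using (Bool; true; false; not)
import Data.Bool.Properties as Bool
open import Data.Empty using (⊥-elim)
open import Data.Fin using (Fin; zero; suc; toℕ)
open import Data.Fin.Properties using (_≟_; toℕ-injective; toℕ<n; toℕ-fromℕ<)
open import Data.Fin.Subset using (_∈_; _∉_; _⊆_; ⊤; _-_; ∣_∣)
open import Data.Fin.Subset.Properties using (∈⊤; ⊆-antisym; p─q⊆p; x∈p∧x≢y⇒x∈p-y; x∈p⇒∣p-x∣<∣p∣)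
open import Data.List using ([]; _∷_; _++_; length)
open import Data.List.Membership.Propositional using (lose; find) renaming (_∈_ to _∈ₗ_)
open import Data.List.Membership.Propositional.Properties using (∈-++⁺ˡ; ∈-++⁺ʳ; ∈-++⁻)
open import Data.List.Properties using (++-identityʳ; length-++)
open import Data.List.Relation.Binary.Permutation.Propositional using (_↭_; prep; ↭-refl; ↭-trans; ↭-sym; ↭⇒↭ₛ)
open import Data.List.Relation.Binary.Permutation.Propositional.Properties using (All-resp-↭; ∈-resp-↭; ↭-length; ++-comm)
open import Data.List.Relation.Binary.Permutation.Setoid.Properties using (Unique-resp-↭)
open import Data.List.Relation.Binary.Sublist.Propositional using ([]; _∷ʳ_; _∷_; minimum; ⊆-refl; ⊆-trans) renaming (_⊆_ to _⊑_)
open import Data.List.Relation.Unary.All as All using (All; []; _∷_)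
import Data.List.Relation.Unary.All.Properties as Allₚ
open import Data.List.Relation.Unary.AllPairs as AllPairs using (AllPairs; []; _∷_)
open import Data.List.Relation.Unary.Any using (Any; here; there)
open import Data.List.Relation.Unary.Unique.Propositional using (Unique)
import Data.List.Relation.Unary.Unique.Propositional.Properties as Uniqueₚ
open import Data.Nat using (zero; suc; _+_; _<_; z≤n; s≤s; _≤?_; _<?_)
open import Data.Nat.DivMod using (_mod_; m<n⇒m%n≡m; m%n<n)
import Data.Nat.Properties as ℕ
open import Data.Nat.Solver using (module +-*-Solver)
open import Data.Product using (∃; ∃₂; _,_; proj₁; proj₂)
open import Data.Sum using (_⊎_; inj₁; inj₂)
open import Data.Vec using ([]; _∷_; tabulate; here; there)
open import Data.Vec.Properties using (≡-dec; lookup∘tabulate; lookup⇒[]=; []=⇒lookup)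
open import Function using (_∘_; id; case_of_)
open import Function.Bundles using (mk⇔; module Equivalence)
open import Relation.Binary.PropositionalEquality as ≡ using (_≡_; _≢_; refl; trans; cong; subst)
open import Relation.Nullary using (¬_; yes; no; Dec; does; contradiction)
open import Relation.Nullary.Decidable using (_×-dec_; dec-true)
open import Relation.Unary using (Decidable)

≢-from-∈- : ∀ {n} {S : Subset n} {x r} → x ∈ S - r → x ≢ r
≢-from-∈- {S = S} {r = r} x∈ refl = r∉S-r S r x∈
  where
  r∉S-r : ∀ {n} (S : Subset n) r → r ∉ S - r
  r∉S-r (true ∷ _)  zero ()
  r∉S-r (false ∷ _) zero ()
  r∉S-r (_ ∷ S) (suc r) (there r∈) = r∉S-r S r r∈

-⊆ : ∀ {n} {S : Subset n} {r} → S - r ⊆ S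
-⊆ {S = S} {r} = p─q⊆p S _

-- Search trees described through their tubes and roots.

module SearchTrees {n : ℕ} (G : Graph n) where

  Tubes : Set
  Tubes = List (Subset n)

  reach-start : ∀ {S x y} → Reach G S x y → x ∈ S
  reach-start (here x∈S)      = x∈S
  reach-start (there x∈S _ _) = x∈S

  reach-mono : ∀ {S S′ x y} → S ⊆ S′ → Reach G S x y → Reach G S′ x y
  reach-mono S⊆ (here x∈S)           = here (S⊆ x∈S)
  reach-mono S⊆ (there x∈S x~w w⇝y) = there (S⊆ x∈S) x~w (reach-mono S⊆ w⇝y)

  reach-snoc : ∀ {S x y z} → Reach G S x y → Adj G y z → z ∈ S → Reach G S x z
  reach-snoc (here y∈S)           y~z z∈S = there y∈S y~z (here z∈S)
  reach-snoc (there x∈S x~w w⇝y) y~z z∈S = there x∈S x~w (reach-snoc w⇝y y~z z∈S)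

  -- The root of a tube S is the vertex r whose smallest containing tube is S.
  record Root (T : Tubes) (S : Subset n) (r : Fin n) : Set where
    constructor root
    field
      tube   : S ∈ˡ T
      inside : r ∈ S
      least  : ∀ {U} → U ∈ˡ T → r ∈ U → S ⊆ U
  open Root

  -- For connected C, this says that C is a component of P - u.
  record Child (P : Subset n) (u : Fin n) (C : Subset n) : Set where
    constructor child
    field
      sub    : C ⊆ P
      avoids : u ∉ C
      closed : ∀ {x y} → x ∈ C → y ∈ P → y ≢ u → Adj G x y → y ∈ C
  open Child

  -- A walk inside `S` stays in `P` and avoids `u`, so each of its edges is one along which `C` is
  -- closed.
  absorb : ∀ {P u C S x} → Child P u C → ConnectedSet G S → S ⊆ P → u ∉ S →
           x ∈ S → x ∈ C → S ⊆ C
  absorb {P} {u} {C} {S} {x} ch (_ , conn) S⊆P u∉S x∈S x∈C y∈S =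
    walk x∈C (conn _ _ x∈S y∈S)
    where
    walk : ∀ {x y} → x ∈ C → Reach G S x y → y ∈ C
    walk x∈C (here _)            = x∈C
    walk x∈C (there _ x~w w⇝y) = walk
      (closed ch x∈C (S⊆P w∈S) (λ { refl → u∉S w∈S }) x~w) w⇝y
      where w∈S = reach-start w⇝y

  -- The arguments about rotations use only these facts and not the recursion behind them. The case
  -- `t ≡ S` in `connected` is there because a derivation certifies only the components below the
  -- root as connected.
  record TreeFacts (S : Subset n) (T : Tubes) : Set where
    field
      top       : S ∈ˡ T
      within    : ∀ {t} → t ∈ˡ T → t ⊆ S
      connected : ∀ {t} → t ∈ˡ T → t ≡ S ⊎ ConnectedSet G t
      rooted    : ∀ {t} → t ∈ˡ T → ∃ (Root T t)
      parent    : ∀ {t} → t ∈ˡ T → t ≡ S ⊎ (∃₂ λ P u → Root T P u × Child P u t)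
      children  : ∀ {P u x} → Root T P u → x ∈ P → x ≢ u →
                  ∃ λ C → C ∈ˡ T × Child P u C × x ∈ C
  open TreeFacts

  -- `apart` is what transfers leastness from one subtree to the whole tree: a tube outside `Tᵢ`
  -- contains no vertex of `Cᵢ`, so it cannot compete for the roots found there.
  record Located (Cs : Tubes) (Ts : Tubes) (t : Subset n) : Set where
    field
      {Cᵢ}   : Subset n
      {Tᵢ}   : Tubes
      Cᵢ∈Cs  : Cᵢ ∈ˡ Cs
      facts  : TreeFacts Cᵢ Tᵢ
      t∈T    : t ∈ˡ Tᵢ
      T⊆Ts   : ∀ {U} → U ∈ˡ Tᵢ → U ∈ˡ Ts
      apart  : ∀ {U} → U ∈ˡ Ts → U ∈ˡ Tᵢ ⊎ (∀ {x} → x ∈ Cᵢ → x ∉ U)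

    lift-root : ∀ {S P u} → Cᵢ ⊆ S → Root Tᵢ P u → Root (S ∷ Ts) P u
    lift-root C⊆S ρ = root (there (T⊆Ts (tube ρ))) (inside ρ) λ where
      (here refl) _   → C⊆S ∘ within facts (tube ρ)
      (there U∈)  u∈U → case apart U∈ of λ where
        (inj₁ U∈T) → least ρ U∈T u∈U
        (inj₂ C∥U) → ⊥-elim (C∥U (within facts (tube ρ) (inside ρ)) u∈U)

  Separated : Subset n → Subset n → Set
  Separated C D = ∀ u v → u ∈ C → v ∈ D → (u ≢ v) × ¬ Adj G u v

  mutual
    forest : ∀ {Cs Ts} → SearchForest G Cs Ts → AllPairs Separated Cs →
             ∀ {t} → t ∈ˡ Ts → Located Cs Ts t
    forest (_∷_ {C} {Cs} {T} {Ts} d ds) (C∥Cs ∷ pairs) t∈ with ∈-++⁻ T t∈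
    ... | inj₁ t∈T = record
      { Cᵢ∈Cs = here refl ; facts = tree d ; t∈T = t∈T ; T⊆Ts = ∈-++⁺ˡ ; apart = apart }
      where
      apart : ∀ {U} → U ∈ˡ (T ++ Ts) → U ∈ˡ T ⊎ (∀ {x} → x ∈ C → x ∉ U)
      apart U∈ with ∈-++⁻ T U∈
      ... | inj₁ U∈T  = inj₁ U∈T
      ... | inj₂ U∈Ts = inj₂ λ x∈C x∈U →
        proj₁ (All.lookup C∥Cs (Located.Cᵢ∈Cs L) _ _ x∈C
                 (within (Located.facts L) (Located.t∈T L) x∈U)) refl
        where L = forest ds pairs U∈Ts
    ... | inj₂ t∈Ts = record
      { Cᵢ∈Cs = there (Located.Cᵢ∈Cs L) ; facts = Located.facts L ; t∈T = Located.t∈T L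
      ; T⊆Ts = ∈-++⁺ʳ T ∘ Located.T⊆Ts L ; apart = apart }
      where
      L = forest ds pairs t∈Ts
      apart : ∀ {U} → U ∈ˡ (T ++ Ts) → U ∈ˡ Located.Tᵢ L ⊎ (∀ {x} → x ∈ Located.Cᵢ L → x ∉ U)
      apart U∈ with ∈-++⁻ T U∈
      ... | inj₁ U∈T  = inj₂ λ x∈D x∈U →
        proj₁ (All.lookup C∥Cs (Located.Cᵢ∈Cs L) _ _ (within (tree d) U∈T x∈U) x∈D) refl
      ... | inj₂ U∈Ts = Located.apart L U∈Ts

    heads : ∀ {Cs Ts} → SearchForest G Cs Ts → ∀ {C} → C ∈ˡ Cs → C ∈ˡ Ts
    heads (d ∷ ds) (here refl) = ∈-++⁺ˡ (top (tree d))
    heads (_∷_ {T = T} d ds) (there C∈) = ∈-++⁺ʳ T (heads ds C∈)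

    tree : ∀ {S T} → IsSearchTree G S T → TreeFacts S T
    tree (node {S} {r} {Cs} {Ts} r∈S (conn , cover , pairs) f) = record
      { top       = here refl
      ; within    = λ where
          (here refl) → id
          (there t∈)  → let L = locate t∈ in C⊆S (Cᵢ∈Cs L) ∘ within (facts L) (t∈T L)
      ; connected = λ where
          (here refl) → inj₁ refl
          (there t∈)  → let L = locate t∈ in case connected (facts L) (t∈T L) of λ where
            (inj₁ eq) → inj₂ (subst (ConnectedSet G) (≡.sym eq) (All.lookup conn (Cᵢ∈Cs L)))
            (inj₂ c)  → inj₂ c
      ; rooted    = λ where
          (here refl) → r , rootS
          (there t∈)  → let L = locate t∈ ; (v , ρ) = rooted (facts L) (t∈T L)
                        in v , lift-root L (C⊆S (Cᵢ∈Cs L)) ρ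
      ; parent    = λ where
          (here refl) → inj₁ refl
          (there t∈)  → let L = locate t∈ in case parent (facts L) (t∈T L) of λ where
            (inj₁ eq) → inj₂ (S , r , rootS , subst (Child S r) (≡.sym eq) (component (Cᵢ∈Cs L)))
            (inj₂ (P , u , ρ , ch)) → inj₂ (P , u , lift-root L (C⊆S (Cᵢ∈Cs L)) ρ , ch)
      ; children  = below
      }
      where
      open Located
      locate : ∀ {t} → t ∈ˡ Ts → Located Cs Ts t
      locate = forest f pairs

      C⊆ : ∀ {C} → C ∈ˡ Cs → C ⊆ S - r
      C⊆ C∈ x∈C = Equivalence.from (cover _) (lose C∈ x∈C)

      C⊆S : ∀ {C} → C ∈ˡ Cs → C ⊆ S
      C⊆S C∈ = -⊆ ∘ C⊆ C∈

      rootS : Root (S ∷ Ts) S r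
      rootS = root (here refl) r∈S λ where
        (here refl) _   → id
        (there U∈)  r∈U → let L = locate U∈ in
          ⊥-elim (≢-from-∈- (C⊆ (Cᵢ∈Cs L) (within (facts L) (t∈T L) r∈U)) refl)

      pieces : ∀ {x} → x ∈ S → x ≢ r → ∃ λ C → C ∈ˡ Cs × x ∈ C
      pieces x∈S x≢r = find (Equivalence.to (cover _) (x∈p∧x≢y⇒x∈p-y x∈S x≢r))

      separated : ∀ {Ds C D x y} → AllPairs Separated Ds → C ∈ˡ Ds → D ∈ˡ Ds →
                  x ∈ C → y ∈ D → Adj G x y → y ∈ C
      separated (_ ∷ _)  (here refl) (here refl) _ y∈ _ = y∈
      separated (s ∷ _)  (here refl) (there D∈) x∈ y∈ x~y =
        ⊥-elim (proj₂ (All.lookup s D∈ _ _ x∈ y∈) x~y)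
      separated (s ∷ _)  (there C∈) (here refl) x∈ y∈ x~y =
        ⊥-elim (proj₂ (All.lookup s C∈ _ _ y∈ x∈) (Graph.sym G x~y))
      separated (_ ∷ ps) (there C∈) (there D∈) x∈ y∈ x~y = separated ps C∈ D∈ x∈ y∈ x~y

      component : ∀ {C} → C ∈ˡ Cs → Child S r C
      component C∈ = child (C⊆S C∈) (λ r∈C → ≢-from-∈- (C⊆ C∈ r∈C) refl)
        λ x∈C y∈S y≢r x~y → let (D , D∈ , y∈D) = pieces y∈S y≢r
                             in separated pairs C∈ D∈ x∈C y∈D x~y

      below : ∀ {P u x} → Root (S ∷ Ts) P u → x ∈ P → x ≢ u →
              ∃ λ C → C ∈ˡ (S ∷ Ts) × Child P u C × x ∈ C
      below {u = u} (root (here refl) u∈S least) x∈S x≢u with u ≟ r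
      ... | yes refl = let (C , C∈ , x∈C) = pieces x∈S x≢u
                       in C , there (heads f C∈) , component C∈ , x∈C
      -- A second root `u` of `S` would lie in a component `C` of `S - r`, and leastness of `S` at
      -- `u` would put `r` into `C`.
      ... | no u≢r   = let (C , C∈ , u∈C) = pieces u∈S u≢r
                       in ⊥-elim (≢-from-∈- (C⊆ C∈ (least (there (heads f C∈)) u∈C r∈S)) refl)
      below (root (there P∈) u∈P least) x∈P x≢u =
        let L = locate P∈
            (C , C∈ , ch , x∈C) =
              children (facts L) (root (t∈T L) u∈P (least ∘ there ∘ T⊆Ts L)) x∈P x≢u
        in C , there (T⊆Ts L C∈) , ch , x∈C

  -- Rotations as exchanges of two roots.

  root-unique : ∀ {S₀ T S r r′} → TreeFacts S₀ T → Root T S r → Root T S r′ → r ≡ r′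
  root-unique {r = r} {r′} F ρ ρ′ with r′ ≟ r
  ... | yes r′≡r = ≡.sym r′≡r
  ... | no  r′≢r = let (C , C∈ , ch , r′∈C) = children F ρ (inside ρ′) r′≢r
                   in ⊥-elim (avoids ch (least ρ′ C∈ r′∈C (inside ρ)))

  -- A rotation swaps the root u of P with the root v of its child t:
  -- afterwards v is the root of P and u is the root of the new tube t′.
  record Exchange (T T′ : Tubes) : Set where
    field
      {P t t′} : Subset n
      {u v}    : Fin n
      P-old    : Root T P u
      t-old    : Root T t v
      P-new    : Root T′ P v
      t-new    : Root T′ t′ u
      t-child  : Child P u t
      t′-child : Child P v t′
      confine  : ∀ {S r x} → Root T S r → r ≢ u → r ≢ v → r ∈ P → x ∈ S → x ∈ t′ → S ⊆ t′
      keep     : ∀ {S r} → Root T S r → r ≢ u → r ≢ v → Root T′ S r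

  module _ (conn : Connected G) where

    tube-connected : ∀ {T t} → TreeFacts ⊤ T → t ∈ˡ T → ConnectedSet G t
    tube-connected F t∈ with connected F t∈
    ... | inj₁ refl = conn
    ... | inj₂ c    = c

    component-unique : ∀ {P u C D x} → Child P u C → ConnectedSet G C →
                       Child P u D → ConnectedSet G D → x ∈ C → x ∈ D → C ≡ D
    component-unique c cC d cD x∈C x∈D = ⊆-antisym
      (absorb d cC (sub c) (avoids c) x∈C x∈D) (absorb c cD (sub d) (avoids d) x∈D x∈C)

    -- The parent `P` of the lost tube `t` survives, and `v` is read off as its root in `T′`. The
    -- rest comes from comparing the components of `P - u`, which are tubes of `T`, with those of
    -- `P - v`, which are tubes of `T′`.
    exchange : ∀ {T T′} → TreeFacts ⊤ T → TreeFacts ⊤ T′ → Rotation G T T′ → Exchange T T′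
    exchange {T} {T′} F F′ (t , t′ , t∈T , t∉T′ , t′∈T′ , t′∉T , old , new)
      with parent F t∈T
    ... | inj₁ refl = ⊥-elim (t∉T′ (top F′))
    ... | inj₂ (P , u , P-old , t-child) with rooted F′ (old P (tube P-old) P≢t)
      where
      P≢t : P ≢ t
      P≢t refl = avoids t-child (inside P-old)
    ... | v , P-new = record
      { P-old = P-old ; t-old = t-old ; P-new = P-new ; t-new = t-new
      ; t-child = t-child ; t′-child = t′-child ; confine = confine ; keep = keep }
      where
      _≟ₛ_ : (U V : Subset n) → Dec (U ≡ V)
      _≟ₛ_ = ≡-dec Bool._≟_

      -- If `P` kept its root, it would keep its children, and `t` would survive.
      v≢u : v ≢ u
      v≢u refl =
        let c = tube-connected F t∈T
            (x , x∈t) = proj₁ c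
            (C , C∈T′ , ch , x∈C) = children F′ P-new (sub t-child x∈t)
                                      (λ { refl → avoids t-child x∈t })
        in t∉T′ (subst (_∈ˡ T′)
             (component-unique ch (tube-connected F′ C∈T′) t-child c x∈C x∈t) C∈T′)

      -- A component of `P - u` other than `t` survives in `T′`. If it contained `v`, the new root
      -- of `P`, it would contain all of `P` and in particular `u`. The same argument with the trees
      -- exchanged gives `new-child`.
      v∈t : v ∈ t
      v∈t with children F P-old (inside P-new) v≢u
      ... | C , C∈T , ch , v∈C with C ≟ₛ t
      ...   | yes refl = v∈C
      ...   | no  C≢t  = ⊥-elim (avoids ch (least P-new (old C C∈T C≢t) v∈C (inside P-old)))

      new-child : u ∈ t′ × Child P v t′
      new-child with children F′ P-new (inside P-old) (v≢u ∘ ≡.sym)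
      ... | C , C∈T′ , ch , u∈C with C ≟ₛ t′
      ...   | yes refl = u∈C , ch
      ...   | no  C≢t′ = ⊥-elim (avoids ch (least P-old (new C C∈T′ C≢t′) u∈C (inside P-new)))

      u∈t′ = proj₁ new-child
      t′-child = proj₂ new-child

      t-old : Root T t v
      t-old = root t∈T v∈t λ {U} U∈T v∈U → case U ≟ₛ t of λ where
        (yes refl) → id
        (no U≢t)   → least P-new (old U U∈T U≢t) v∈U ∘ sub t-child

      t-new : Root T′ t′ u
      t-new = root t′∈T′ u∈t′ λ {U} U∈T′ u∈U → case U ≟ₛ t′ of λ where
        (yes refl) → id
        (no U≢t′)  → least P-old (new U U∈T′ U≢t′) u∈U ∘ sub t′-child

      confine : ∀ {S r x} → Root T S r → r ≢ u → r ≢ v → r ∈ P → x ∈ S → x ∈ t′ → S ⊆ t′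
      confine {S} {r} ρ r≢u r≢v r∈P x∈S x∈t′ =
        absorb t′-child c S⊆P v∉S x∈S x∈t′
        where
        c = tube-connected F (tube ρ)
        S⊆P : S ⊆ P
        S⊆P = least ρ (tube P-old) r∈P
        u∉S : u ∉ S
        u∉S u∈S with refl ← ⊆-antisym S⊆P (least P-old (tube ρ) u∈S) =
          r≢u (root-unique F ρ P-old)
        -- If `v` were in `S`, then `S`, a connected subset of `P - u` meeting `t`, would lie in
        -- `t`; leastness of `t` at `v` would make them equal, with two different roots.
        v∉S : v ∉ S
        v∉S v∈S with refl ← ⊆-antisym (absorb t-child c S⊆P u∉S v∈S v∈t) (least t-old (tube ρ) v∈S) =
          r≢v (root-unique F ρ t-old)

      keep : ∀ {S r} → Root T S r → r ≢ u → r ≢ v → Root T′ S r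
      keep {S} {r} ρ r≢u r≢v = root (old S (tube ρ) S≢t) (inside ρ) least′
        where
        S≢t : S ≢ t
        S≢t refl = r≢v (root-unique F ρ t-old)
        least′ : ∀ {U} → U ∈ˡ T′ → r ∈ U → S ⊆ U
        least′ {U} U∈T′ r∈U with U ≟ₛ t′
        -- Only the new tube `t′` could be a smaller tube around `r`, and if it contains `r` it
        -- contains all of `S`.
        ... | yes refl = confine ρ r≢u r≢v (sub t′-child r∈U) (inside ρ) r∈U
        ... | no U≢t′  = least ρ (new U U∈T′ U≢t′) r∈U

  -- Alternating chains under a rotation.

  module Alternation (Half : Bool → Fin n → Set) (p : Fin n)
                     (disjoint : ∀ {c x} → Half c x → ¬ Half (not c) x) where

    infixr 5 _∷⟨_⟩_

    -- Alt T c X a: a descending chain of a tubes containing p whose roots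
    -- lie alternately in the two halves, starting inside X and in half c.
    data Alt (T : Tubes) : Bool → Subset n → ℕ → Set where
      []      : ∀ {c X} → Alt T c X 0
      _∷⟨_⟩_ : ∀ {c X S r a} → Root T S r → r ∈ X × p ∈ S × Half c r →
                Alt T (not c) S a → Alt T c X (suc a)

    ClosedIn : Tubes → Subset n → Set
    ClosedIn T X = ∀ {S r} → Root T S r → r ∈ X → S ⊆ X

    tube-closed : ∀ {T S r} → Root T S r → ClosedIn T S
    tube-closed ρ ρ′ r′∈S = least ρ′ (tube ρ) r′∈S

    module _ {T T′ : Tubes} (F : TreeFacts ⊤ T) (E : Exchange T T′) where
      open Exchange E

      -- A tube rooted at `u` or `v` is `P` or `t`; it is replaced by `P`, whose new root is `v`.
      -- Tubes only grow, so they still contain `p` and the chain still descends. The guard `u ∈ X`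
      -- makes the condition on halves vacuous once the chain has passed below `u`.
      slide : ∀ {c X X′ a} → (∀ {c} → u ∈ X → Half c u → Half c v) →
              ClosedIn T X → X ⊆ X′ → Alt T c X a → Alt T′ c X′ a
      slide _ _ _ [] = []
      slide {X = X} same cl X⊆ (_∷⟨_⟩_ {S = S} {r} ρ (r∈X , p∈S , h) rest) with r ≟ u | r ≟ v
      ... | yes refl | _ =
        P-new ∷⟨ X⊆ (cl P-old r∈X (inside P-new)) , S⊆P p∈S , same r∈X h ⟩
        slide (same ∘ cl ρ r∈X) (tube-closed ρ) S⊆P rest
        where
        S⊆P : S ⊆ P
        S⊆P = least ρ (tube P-old) (inside P-old)
      ... | no _ | yes refl =
        P-new ∷⟨ X⊆ r∈X , S⊆P p∈S , h ⟩
        slide (same ∘ cl ρ r∈X) (tube-closed ρ) S⊆P rest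
        where
        S⊆P : S ⊆ P
        S⊆P = sub t-child ∘ least ρ (tube t-old) (inside t-old)
      ... | no r≢u | no r≢v =
        keep ρ r≢u r≢v ∷⟨ X⊆ r∈X , p∈S , h ⟩
        slide (same ∘ cl ρ r∈X) (tube-closed ρ) id rest

      -- This treats a `v` outside both halves. The tube rooted at `u` shrinks from `P` to `t′`; if
      -- `t′` keeps `p`, the later tubes of the chain meet `t′` in `p` and are confined to it. Since
      -- `X′` may be smaller than `X`, only roots of tubes through `p` are required to pass from one
      -- to the other.
      shelter : ∀ {c X X′ a} → (∀ {c} → ¬ Half c v) →
                (∀ {c} → Half c u → p ∈ P → p ∈ t′) →
                (∀ {S r} → Root T S r → p ∈ S → Half c r → r ∈ X → r ∈ X′) →
                Alt T c X a → Alt T′ c X′ a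
      shelter _ _ _ [] = []
      shelter {c} v∉ conv X↝ (_∷⟨_⟩_ {S = S} {r} ρ (r∈X , p∈S , h) rest) with r ≟ u
      ... | yes refl =
        t-new ∷⟨ X↝ ρ p∈S h r∈X , p∈t′ , h ⟩ shelter v∉ conv S↝t′ rest
        where
        S⊆P : S ⊆ P
        S⊆P = least ρ (tube P-old) (inside P-old)
        p∈t′ : p ∈ t′
        p∈t′ = conv h (S⊆P p∈S)
        S↝t′ : ∀ {S₂ r₂} → Root T S₂ r₂ → p ∈ S₂ → Half (not c) r₂ → r₂ ∈ S → r₂ ∈ t′
        S↝t′ ρ₂ p∈S₂ h₂ r₂∈S = confine ρ₂ (λ { refl → disjoint h h₂ }) (λ { refl → v∉ h₂ })
          (S⊆P r₂∈S) p∈S₂ p∈t′ (inside ρ₂)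
      ... | no r≢u =
        keep ρ r≢u (λ { refl → v∉ h }) ∷⟨ X↝ ρ p∈S h r∈X , p∈S , h ⟩
        shelter v∉ conv (λ _ _ _ → id) rest

      -- Once the chain has passed below `u`, `slide` applies vacuously. If `v` is met before `u`,
      -- the tube rooted there grows to `P` and nothing is lost; if `u` is met, two entries are
      -- dropped.
      shorten : ∀ {c X a} → ClosedIn T X → Alt T c X a →
                ∃ λ b → Alt T′ c X b × a ≤ 2 + b
      shorten _ [] = 0 , [] , z≤n
      shorten {c} {X} cl (_∷⟨_⟩_ {S = S} {r} ρ (r∈X , p∈S , h) rest) with r ≟ u | r ≟ v
      shorten _ (_ ∷⟨ _ ⟩ []) | yes refl | _ = 0 , [] , s≤s z≤n
      -- Dropping only the entry rooted at `u` would make the rest start in the wrong half; dropping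
      -- its successor as well restores the half `c`.
      shorten {c} {X} cl (_∷⟨_⟩_ {S = S} ρ (u∈X , _ , h) (_∷⟨_⟩_ {S = S₂} {a = a} ρ₂ (r₂∈S , _ , h₂) rest)) | yes refl | _ =
        a , subst (λ c → Alt T′ c X a) (Bool.not-involutive c)
              (slide (⊥-elim ∘ u∉S₂) (tube-closed ρ₂) (cl ρ u∈X ∘ S₂⊆S) rest)
          , ℕ.≤-refl
        where
        S₂⊆S : S₂ ⊆ S
        S₂⊆S = tube-closed ρ ρ₂ r₂∈S
        u∉S₂ : u ∉ S₂
        u∉S₂ u∈S₂ with refl ← ⊆-antisym S₂⊆S (least ρ (tube ρ₂) u∈S₂)
          with refl ← root-unique F ρ ρ₂ = disjoint h h₂
      ... | no _ | yes refl =
        _ , P-new ∷⟨ r∈X , S⊆P p∈S , h ⟩ slide (⊥-elim ∘ u∉S) (tube-closed ρ) S⊆P rest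
          , ℕ.m≤n+m _ 2
        where
        S⊆t : S ⊆ t
        S⊆t = least ρ (tube t-old) (inside t-old)
        S⊆P : S ⊆ P
        S⊆P = sub t-child ∘ S⊆t
        u∉S : u ∉ S
        u∉S = avoids t-child ∘ S⊆t
      ... | no r≢u | no r≢v =
        let (b , rest′ , a≤) = shorten (tube-closed ρ) rest
        in suc b , keep ρ r≢u r≢v ∷⟨ r∈X , p∈S , h ⟩ rest′ , s≤s a≤

  -- Path-shaped search trees from elimination orders.

  -- Elim rs: the vertices rs can be deleted in this order, each one leaving a
  -- connected graph.
  data Elim : List (Fin n) → Set where
    [_]  : ∀ r → Elim (r ∷ [])
    _∷_  : ∀ {r rs} → Any (Adj G r) rs → Elim rs → Elim (r ∷ rs)

  record Enumerates (rs : List (Fin n)) (S : Subset n) : Set where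
    constructor enumerates
    field
      to     : ∀ {x} → x ∈ S → x ∈ₗ rs
      from   : ∀ {x} → x ∈ₗ rs → x ∈ S
      unique : Unique rs
  open Enumerates

  delete : ∀ {r rs S} → Enumerates (r ∷ rs) S → Enumerates rs (S - r)
  delete {r} {rs} {S} (enumerates to from (r∉ ∷ uniq)) = enumerates
    (λ x∈ → case to (-⊆ x∈) of λ where
      (here x≡r) → ⊥-elim (≢-from-∈- x∈ x≡r)
      (there x∈) → x∈)
    (λ x∈ → x∈p∧x≢y⇒x∈p-y (from (there x∈)) (λ { refl → All.lookup r∉ x∈ refl }))
    uniq

  -- These are the tubes of the path-shaped search tree with vertices `rs` from the root down.
  -- `Elim` ensures that each deletion leaves a single component.
  chain : Subset n → List (Fin n) → Tubes
  chain S []       = []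
  chain S (r ∷ rs) = S ∷ chain (S - r) rs

  chain-within : ∀ {S U} rs → U ∈ˡ chain S rs → U ⊆ S
  chain-within (r ∷ rs) (here refl) = id
  chain-within (r ∷ rs) (there U∈)  = -⊆ ∘ chain-within rs U∈

  chain-tail : ∀ {S x rs U} → U ∈ˡ chain S (x ∷ rs) ⊎ S ⊆ U → U ∈ˡ chain (S - x) rs ⊎ S - x ⊆ U
  chain-tail (inj₁ (here refl)) = inj₂ -⊆
  chain-tail (inj₁ (there U∈))  = inj₁ U∈
  chain-tail (inj₂ S⊆U)         = inj₂ (S⊆U ∘ -⊆)

  elim-connected : ∀ {rs S} → Elim rs → Enumerates rs S → ConnectedSet G S
  elim-connected [ r ] e = (r , from e (here refl)) , λ x y x∈S y∈S →
    case to e x∈S of λ { (here refl) → case to e y∈S of λ { (here refl) → here x∈S } }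
  elim-connected {r ∷ rs} {S} (r~ ∷ el) e = (r , r∈S) , reach
    where
    r∈S = from e (here refl)
    w = proj₁ (find r~)
    w∈ = from (delete e) (proj₁ (proj₂ (find r~)))
    r~w = proj₂ (proj₂ (find r~))
    within-rest = proj₂ (elim-connected el (delete e))
    reach : ∀ x y → x ∈ S → y ∈ S → Reach G S x y
    reach x y x∈S y∈S with x ≟ r | y ≟ r
    ... | yes refl | yes refl = here x∈S
    ... | yes refl | no y≢r   =
      there x∈S r~w (reach-mono -⊆ (within-rest _ _ w∈ (x∈p∧x≢y⇒x∈p-y y∈S y≢r)))
    ... | no x≢r   | yes refl =
      reach-snoc (reach-mono -⊆ (within-rest _ _ (x∈p∧x≢y⇒x∈p-y x∈S x≢r) w∈)) (Graph.sym G r~w) y∈S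
    ... | no x≢r   | no y≢r   =
      reach-mono -⊆ (within-rest _ _ (x∈p∧x≢y⇒x∈p-y x∈S x≢r) (x∈p∧x≢y⇒x∈p-y y∈S y≢r))

  elim-tree : ∀ {rs S} → Elim rs → Enumerates rs S → IsSearchTree G S (chain S rs)
  elim-tree [ r ] e = node (from e (here refl))
    ([] , (λ v → mk⇔ (λ v∈ → case to (delete e) v∈ of λ ()) (λ ())) , []) []
  elim-tree {r ∷ rs} {S} (r~ ∷ el) e = node (from e (here refl))
    ( elim-connected el (delete e) ∷ []
    , (λ v → mk⇔ here (λ { (here v∈) → v∈ }))
    , [] ∷ [] )
    (subst (SearchForest G ((S - r) ∷ [])) (++-identityʳ _) (elim-tree el (delete e) ∷ []))

  chain-sorted : ∀ {rs S x} → Enumerates rs S → AllPairs (λ x y → toℕ x < toℕ y) rs → x ∈ₗ rs →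
                 ∃ λ U → U ∈ˡ chain S rs × x ∈ U × (∀ {y} → y ∈ U → toℕ x ≤ toℕ y)
  chain-sorted {S = S} e (x< ∷ _) (here refl) = S , here refl , from e (here refl) ,
    λ y∈S → case to e y∈S of λ where
      (here refl) → ℕ.≤-refl
      (there y∈)  → ℕ.<⇒≤ (All.lookup x< y∈)
  chain-sorted e (_ ∷ lt) (there x∈) =
    let (U , U∈ , rest) = chain-sorted (delete e) lt x∈ in U , there U∈ , rest

  module ChainAlternation (Half : Bool → Fin n → Set) (p : Fin n)
                          (disjoint : ∀ {c x} → Half c x → ¬ Half (not c) x) where
    open Alternation Half p disjoint

    data Alternates : Bool → List (Fin n) → Set where
      []  : ∀ {c} → Alternates c []
      _∷_ : ∀ {c r rs} → Half c r → Alternates (not c) rs → Alternates c (r ∷ rs)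

    -- A vertex of `xs` is the root of the set remaining just before its deletion, and `p` is still
    -- there because it is deleted later. The invariant that every tube of `T` is in the remaining
    -- chain or contains `S` yields leastness.
    chain-alt : ∀ {T S X c ys xs zs} → Enumerates (xs ++ zs) S → p ∈ₗ zs →
                (∀ {U} → U ∈ˡ T → U ∈ˡ chain S (xs ++ zs) ⊎ S ⊆ U) →
                (∀ {U} → U ∈ˡ chain S (xs ++ zs) → U ∈ˡ T) → S ⊆ X →
                ys ⊑ xs → Alternates c ys → Alt T c X (length ys)
    chain-alt _ _ _ _ _ [] [] = []
    chain-alt {T} {S} {X} {xs = x ∷ xs} {zs} e p∈ split emb S⊆X (y ∷ʳ sub) alt =
      chain-alt (delete e) p∈ (chain-tail ∘ split) (emb ∘ there) (S⊆X ∘ -⊆) sub alt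
    chain-alt {T} {S} {X} {xs = x ∷ xs} {zs} e p∈ split emb S⊆X (refl ∷ sub) (h ∷ alt) =
      rootS ∷⟨ S⊆X x∈S , from e (there (∈-++⁺ʳ xs p∈)) , h ⟩
      chain-alt (delete e) p∈ (chain-tail ∘ split) (emb ∘ there) -⊆ sub alt
      where
      x∈S = from e (here refl)
      rootS : Root T S x
      rootS = root (emb (here refl)) x∈S λ U∈ x∈U → case split U∈ of λ where
        (inj₁ (here refl)) → id
        (inj₁ (there U∈′)) → ⊥-elim (≢-from-∈- (chain-within (xs ++ zs) U∈′ x∈U) refl)
        (inj₂ S⊆U)         → S⊆U

-- The square of a path and its pathwidth.

Square : ∀ n → Graph n
Square n = record
  { Adj    = λ u v → u ≢ v × toℕ u ≤ 2 + toℕ v × toℕ v ≤ 2 + toℕ u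
  ; sym    = λ (u≢v , u≤ , v≤) → u≢v ∘ ≡.sym , v≤ , u≤
  ; irrefl = λ (u≢u , _) → u≢u refl
  }

select : ∀ {n} {P : Fin n → Set} → Decidable P → Subset n
select P? = tabulate (does ∘ P?)

∈-select⁺ : ∀ {n} {P : Fin n → Set} (P? : Decidable P) {x} → P x → x ∈ select P?
∈-select⁺ P? {x} px =
  lookup⇒[]= x _ (trans (lookup∘tabulate (does ∘ P?) x) (dec-true (P? x) px))

∈-select⁻ : ∀ {n} {P : Fin n → Set} (P? : Decidable P) {x} → x ∈ select P? → P x
∈-select⁻ P? {x} x∈ with P? x | trans (≡.sym (lookup∘tabulate (does ∘ P?) x)) ([]=⇒lookup x∈)
... | yes px | _ = px

window-size : ∀ {n} (S : Subset n) a w → (∀ {x} → x ∈ S → a ≤ toℕ x × toℕ x < a + w) → ∣ S ∣ ≤ w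
window-size []          _       _       _  = z≤n
window-size (false ∷ S) zero    zero    in∈ = window-size S 0 0 λ x∈ → case proj₂ (in∈ (there x∈)) of λ ()
window-size (false ∷ S) zero    (suc w) in∈ =
  ℕ.m≤n⇒m≤1+n (window-size S 0 w λ x∈ → z≤n , ℕ.≤-pred (proj₂ (in∈ (there x∈))))
window-size (false ∷ S) (suc a) w       in∈ = window-size S a w λ x∈ →
  let (a≤ , <a) = in∈ (there x∈) in ℕ.≤-pred a≤ , ℕ.≤-pred <a
window-size (true ∷ S)  zero    zero    in∈ = case proj₂ (in∈ here) of λ ()
window-size (true ∷ S)  zero    (suc w) in∈ =
  s≤s (window-size S 0 w λ x∈ → z≤n , ℕ.≤-pred (proj₂ (in∈ (there x∈))))
window-size (true ∷ S)  (suc a) w       in∈ = case proj₁ (in∈ here) of λ ()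

square-width≤2 : ∀ n → PathDecomposition (Square n) 2
square-width≤2 n = record
  { m          = n
  ; bag        = λ i → select (window? i)
  ; covers     = λ v → v , ∈-select⁺ (window? v) (ℕ.≤-refl , ℕ.m≤n+m _ 2)
  ; edges      = λ u v (_ , u≤ , v≤) → case ℕ.≤-total (toℕ u) (toℕ v) of λ where
      (inj₁ u≤v) → u , ∈-select⁺ (window? u) (ℕ.≤-refl , ℕ.m≤n+m _ 2) , ∈-select⁺ (window? u) (u≤v , v≤)
      (inj₂ v≤u) → v , ∈-select⁺ (window? v) (v≤u , u≤) , ∈-select⁺ (window? v) (ℕ.≤-refl , ℕ.m≤n+m _ 2)
  ; contiguous = λ v i j k i≤j j≤k v∈i v∈k → ∈-select⁺ (window? j)
      ( ℕ.≤-trans j≤k (proj₁ (∈-select⁻ (window? k) v∈k))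
      , ℕ.≤-trans (proj₂ (∈-select⁻ (window? i) v∈i)) (ℕ.+-monoʳ-≤ 2 i≤j) )
  ; width      = λ i → window-size (select (window? i)) (toℕ i) 3 λ {x} x∈ →
      let (i≤x , x≤) = ∈-select⁻ (window? i) x∈
      in i≤x , subst (suc (toℕ x) ≤_) (ℕ.+-comm 3 (toℕ i)) (s≤s x≤)
  }
  where
  window? : (i v : Fin n) → Dec (toℕ i ≤ toℕ v × toℕ v ≤ 2 + toℕ i)
  window? i v = (toℕ i ≤? toℕ v) ×-dec (toℕ v ≤? 2 + toℕ i)

three-elements : ∀ {n} {S : Subset n} {x y z} → x ≢ y → y ≢ z → x ≢ z →
                 x ∈ S → y ∈ S → z ∈ S → 3 ≤ ∣ S ∣
three-elements {S = S} {x} {y} {z} x≢y y≢z x≢z x∈S y∈S z∈S =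
  ℕ.≤-trans (s≤s (ℕ.≤-trans (s≤s (ℕ.≤-trans (s≤s z≤n)
    (x∈p⇒∣p-x∣<∣p∣ z∈))) (x∈p⇒∣p-x∣<∣p∣ y∈))) (x∈p⇒∣p-x∣<∣p∣ x∈S)
  where
  y∈ : y ∈ S - x
  y∈ = x∈p∧x≢y⇒x∈p-y y∈S (x≢y ∘ ≡.sym)
  z∈ : z ∈ S - x - y
  z∈ = x∈p∧x≢y⇒x∈p-y (x∈p∧x≢y⇒x∈p-y z∈S (x≢z ∘ ≡.sym)) (y≢z ∘ ≡.sym)

-- Of the three bags containing the edges of the triangle, the one in the
-- middle contains the whole triangle.
triangle-width>1 : ∀ {n} (G : Graph n) {x y z} → x ≢ y → y ≢ z → x ≢ z →
                   Adj G x y → Adj G y z → Adj G x z → ¬ PathDecomposition G 1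
triangle-width>1 G {x} {y} {z} x≢y y≢z x≢z x~y y~z x~z D =
  middle (edges x y x~y) (edges y z y~z) (edges x z x~z)
  where
  open PathDecomposition D
  small : ∀ {i} → x ∈ bag i → y ∈ bag i → ¬ z ∈ bag i
  small {i} x∈ y∈ z∈ = ℕ.<⇒≱ (three-elements x≢y y≢z x≢z x∈ y∈ z∈) (width i)
  middle : (∃ λ i → x ∈ bag i × y ∈ bag i) → (∃ λ j → y ∈ bag j × z ∈ bag j) →
           ¬ (∃ λ k → x ∈ bag k × z ∈ bag k)
  middle (i , x∈i , y∈i) (j , y∈j , z∈j) (k , x∈k , z∈k)
    with ℕ.≤-total (toℕ i) (toℕ j) | ℕ.≤-total (toℕ j) (toℕ k) | ℕ.≤-total (toℕ i) (toℕ k)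
  ... | inj₁ i≤j | inj₁ j≤k | _        = small (contiguous x i j k i≤j j≤k x∈i x∈k) y∈j z∈j
  ... | inj₁ i≤j | inj₂ k≤j | inj₁ i≤k = small x∈k (contiguous y i k j i≤k k≤j y∈i y∈j) z∈k
  ... | inj₁ i≤j | inj₂ k≤j | inj₂ k≤i = small x∈i y∈i (contiguous z k i j k≤i i≤j z∈k z∈j)
  ... | inj₂ j≤i | inj₁ j≤k | inj₁ i≤k = small x∈i y∈i (contiguous z j i k j≤i i≤k z∈j z∈k)
  ... | inj₂ j≤i | inj₁ j≤k | inj₂ k≤i = small x∈k (contiguous y j k i j≤k k≤i y∈j y∈i) z∈k
  ... | inj₂ j≤i | inj₂ k≤j | _        = small (contiguous x k j i k≤j j≤i x∈k x∈i) y∈j z∈j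

-- Convexity of intervals in the square of a path.

module _ {n : ℕ} where
  open SearchTrees (Square n)

  data Position (lo hi x : ℕ) : Set where
    left   : x < lo → Position lo hi x
    middle : lo ≤ x × x < hi → Position lo hi x
    right  : hi ≤ x → Position lo hi x

  position : ∀ lo hi x → Position lo hi x
  position lo hi x with x <? lo | x <? hi
  ... | yes x<lo | _        = left x<lo
  ... | no  x≮lo | yes x<hi = middle (ℕ.≮⇒≥ x≮lo , x<hi)
  ... | no  _    | no  x≮hi = right (ℕ.≮⇒≥ x≮hi)

  -- The two vertices at either end of an interval are adjacent, so a walk
  -- that leaves the interval and comes back can be shortcut inside it.
  interval-convex : ∀ {P C v u p lo hi} → 2 + lo ≤ hi → Child P v C → ConnectedSet (Square n) P →
                    let Inside = λ x → lo ≤ toℕ x × toℕ x < hi in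
                    ¬ Inside v → Inside u → Inside p → u ∈ C → p ∈ P → p ∈ C
  interval-convex {P} {C} {v} {u} {p} {lo} {hi} wide ch (_ , conn) v∉I u∈I p∈I u∈C p∈P =
    walk start (conn u p (Child.sub ch u∈C) p∈P) p∈I
    where
    I : Fin n → Set
    I x = lo ≤ toℕ x × toℕ x < hi

    -- The shadow of the current vertex `x` of the walk is a vertex `e` of `C` in the interval: `x`
    -- itself if `x` is inside, and otherwise one of the two vertices at the end beyond which `x`
    -- lies.
    record Shadow (x : Fin n) : Set where
      eta-equality
      constructor shadow
      field
        {e}     : Fin n
        e∈C     : e ∈ C
        e∈I     : I e
        onLeft  : toℕ x < lo → toℕ e ≤ suc lo
        onRight : hi ≤ toℕ x → hi ≤ 2 + toℕ e
        onI     : I x → e ≡ x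

    start : Shadow u
    start = shadow u∈C u∈I (λ u<lo → contradiction (proj₁ u∈I) (ℕ.<⇒≱ u<lo))
                           (λ hi≤u → contradiction hi≤u (ℕ.<⇒≱ (proj₂ u∈I))) (λ _ → refl)

    self : ∀ {w} → w ∈ C → I w → Shadow w
    self w∈C w∈I = shadow w∈C w∈I (λ w<lo → contradiction (proj₁ w∈I) (ℕ.<⇒≱ w<lo))
                           (λ hi≤w → contradiction hi≤w (ℕ.<⇒≱ (proj₂ w∈I))) (λ _ → refl)

    -- An edge spans at most two, and the interval has at least two vertices, so no edge jumps over
    -- it.
    no-jump : ∀ {x w} → x < lo → w ≤ 2 + x → ¬ hi ≤ w
    no-jump x<lo w≤ hi≤w = ℕ.<⇒≱ (s≤s (s≤s x<lo)) (ℕ.≤-trans wide (ℕ.≤-trans hi≤w w≤))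

    move : ∀ {x w} → Shadow x → Adj (Square n) x w → w ∈ P → Shadow w
    move {x} {w} (shadow {e} e∈C e∈I onL onR onI) (x≢w , x≤ , w≤) w∈P
      with position lo hi (toℕ w) | position lo hi (toℕ x)
    ... | left w<lo | px = shadow e∈C e∈I (λ _ → near px)
        (λ hi≤w → contradiction (ℕ.≤-trans (ℕ.≤-trans (ℕ.n≤1+n _) wide) hi≤w) (ℕ.<⇒≱ (ℕ.<-trans w<lo (ℕ.n<1+n lo))))
        (λ w∈I → contradiction (proj₁ w∈I) (ℕ.<⇒≱ w<lo))
      where
      near : Position lo hi (toℕ x) → toℕ e ≤ suc lo
      near (left x<lo)  = onL x<lo
      near (middle x∈I) = subst (λ y → toℕ y ≤ suc lo) (≡.sym (onI x∈I)) (ℕ.≤-trans x≤ (s≤s w<lo))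
      near (right hi≤x) = contradiction hi≤x (no-jump w<lo x≤)
    ... | right hi≤w | px = shadow e∈C e∈I
        (λ w<lo → contradiction (ℕ.≤-trans (ℕ.≤-trans (ℕ.n≤1+n _) wide) hi≤w) (ℕ.<⇒≱ (ℕ.<-trans w<lo (ℕ.n<1+n lo))))
        (λ _ → near px)
        (λ w∈I → contradiction hi≤w (ℕ.<⇒≱ (proj₂ w∈I)))
      where
      near : Position lo hi (toℕ x) → hi ≤ 2 + toℕ e
      near (left x<lo)  = contradiction hi≤w (no-jump x<lo w≤)
      near (middle x∈I) = subst (λ y → hi ≤ 2 + toℕ y) (≡.sym (onI x∈I)) (ℕ.≤-trans hi≤w w≤)
      near (right hi≤x) = onR hi≤x
    ... | middle w∈I | px with w ≟ e
    ...   | yes refl = self e∈C w∈I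
    -- A walk that re-enters does so at one of the two vertices at the end where `e` lies, so `e`
    -- and `w` are adjacent; `w` differs from `v`, which is outside the interval.
    ...   | no w≢e   = self (Child.closed ch e∈C w∈P (λ { refl → v∉I w∈I }) (w≢e ∘ ≡.sym , near px)) w∈I
      where
      near : Position lo hi (toℕ x) → toℕ e ≤ 2 + toℕ w × toℕ w ≤ 2 + toℕ e
      near (left x<lo)  = ℕ.≤-trans (onL x<lo) (s≤s (ℕ.m≤n⇒m≤1+n (proj₁ w∈I)))
                        , ℕ.≤-trans w≤ (s≤s (s≤s (ℕ.≤-trans (ℕ.<⇒≤ x<lo) (proj₁ e∈I))))
      near (middle x∈I) with refl ← onI x∈I = x≤ , w≤
      near (right hi≤x) = ℕ.≤-trans (ℕ.<⇒≤ (proj₂ e∈I)) (ℕ.≤-trans hi≤x x≤)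
                        , ℕ.≤-trans (ℕ.<⇒≤ (proj₂ w∈I)) (onR hi≤x)

    walk : ∀ {x y} → Shadow x → Reach (Square n) P x y → I y → y ∈ C
    walk s (here _)            y∈I = subst (_∈ C) (Shadow.onI s y∈I) (Shadow.e∈C s)
    walk s (there _ x~w w⇝y) y∈I = walk (move s x~w (reach-start w⇝y)) w⇝y y∈I

-- Interleavings, runs and elimination orders built from them.

interleave : ∀ {A : Set} → List A → List A → List A
interleave []       ys = ys
interleave (x ∷ xs) ys = x ∷ interleave ys xs

interleave-↭ : ∀ {A : Set} (xs ys : List A) → interleave xs ys ↭ xs ++ ys
interleave-↭ []       ys = ↭-refl
interleave-↭ (x ∷ xs) ys = prep x (↭-trans (interleave-↭ ys xs) (++-comm ys xs))

mutual
  ⊑-interleaveˡ : ∀ {A : Set} (xs ys : List A) → xs ⊑ interleave xs ys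
  ⊑-interleaveˡ []       ys = minimum ys
  ⊑-interleaveˡ (x ∷ xs) ys = refl ∷ ⊑-interleaveʳ ys xs

  ⊑-interleaveʳ : ∀ {A : Set} (xs ys : List A) → ys ⊑ interleave xs ys
  ⊑-interleaveʳ []       ys = ⊆-refl
  ⊑-interleaveʳ (x ∷ xs) ys = x ∷ʳ ⊑-interleaveˡ ys xs

run : ∀ {A : Set} → (ℕ → A) → ℕ → ℕ → List A
run f zero    e = []
run f (suc m) e = f e ∷ run f m (suc e)

∈-run⁺ : ∀ {A : Set} (f : ℕ → A) m {e i} → e ≤ i → i < e + m → f i ∈ₗ run f m e
∈-run⁺ f zero    {e} e≤i i< = contradiction e≤i (ℕ.<⇒≱ (subst (_ <_) (ℕ.+-identityʳ e) i<))
∈-run⁺ f (suc m) {e} {i} e≤i i< with ℕ.m≤n⇒m<n∨m≡n e≤i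
... | inj₁ e<i  = there (∈-run⁺ f m e<i (subst (i <_) (ℕ.+-suc e m) i<))
... | inj₂ refl = here refl

∈-run⁻ : ∀ {A : Set} (f : ℕ → A) m {e x} → x ∈ₗ run f m e → ∃ λ i → e ≤ i × i < e + m × x ≡ f i
∈-run⁻ f (suc m) {e} (here x≡) = e , ℕ.≤-refl , ℕ.m<m+n e (s≤s z≤n) , x≡
∈-run⁻ f (suc m) {e} (there x∈) =
  let (i , e<i , i< , x≡) = ∈-run⁻ f m x∈
  in i , ℕ.<⇒≤ e<i , subst (i <_) (≡.sym (ℕ.+-suc e m)) i< , x≡

run-AllPairs : ∀ {A : Set} {R : A → A → Set} (f : ℕ → A) m {e} →
               (∀ {i j} → i < j → j < e + m → R (f i) (f j)) → AllPairs R (run f m e)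
run-AllPairs f zero    _ = []
run-AllPairs {R = R} f (suc m) {e} mono =
  All.tabulate (λ x∈ → let (i , e<i , i< , x≡) = ∈-run⁻ f m x∈
                       in subst (R (f e)) (≡.sym x≡) (mono e<i (subst (i <_) (≡.sym (ℕ.+-suc e m)) i<)))
  ∷ run-AllPairs f m λ {_} {j} i<j j< → mono i<j (subst (j <_) (≡.sym (ℕ.+-suc e m)) j<)

run-elim : ∀ {n} (G : Graph n) (f : ℕ → Fin n) m {e} →
           (∀ {i} → suc i < e + suc m → Adj G (f i) (f (suc i))) →
           SearchTrees.Elim G (run f (suc m) e)
run-elim G f zero    _   = SearchTrees.Elim.[ _ ]
run-elim G f (suc m) {e} adj =
  here (adj (subst (suc e <_) (≡.sym (ℕ.+-suc e (suc m))) (s≤s (ℕ.m<m+n e (s≤s z≤n)))))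
  SearchTrees.Elim.∷ run-elim G f m λ {i} i< → adj (subst (suc i <_) (≡.sym (ℕ.+-suc e (suc m))) i<)

-- The order of `xs` is arbitrary, since each of its vertices has a neighbour in `ys`, which
-- outlives it. This leaves room for bit reversal on the even vertices.
++-elim : ∀ {n} (G : Graph n) {xs ys} → All (λ x → Any (Adj G x) ys) xs →
          SearchTrees.Elim G ys → SearchTrees.Elim G (xs ++ ys)
++-elim G []         el = el
++-elim G {ys = ys} (_∷_ {xs = xs} x~ xs~) el = any-++ʳ xs x~ SearchTrees.Elim.∷ ++-elim G xs~ el
  where
  any-++ʳ : ∀ xs {x} → Any (Adj G x) ys → Any (Adj G x) (xs ++ ys)
  any-++ʳ xs x~ = let (w , w∈ , x~w) = find x~ in lose (∈-++⁺ʳ xs w∈) x~w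

parity : ∀ m → ∃ λ i → m ≡ 2 * i ⊎ m ≡ suc (2 * i)
parity zero    = 0 , inj₁ refl
parity (suc m) with parity m
... | i , inj₁ refl = i , inj₂ refl
... | i , inj₂ refl = suc i , inj₁ (≡.sym (ℕ.*-suc 2 i))

-- The dyadic potential and its change under rotations.

module DyadicPotential {n : ℕ} (conn : Connected (Square n)) where
  open SearchTrees (Square n)
  open TreeFacts
  open Root

  -- A block consists of `2 ^ j` whole pairs `2 i`, `2 i + 1`. The even members supply the
  -- alternation, and an odd one serves as `p`.
  InBlock : ℕ → ℕ → Fin n → Set
  InBlock j a x = 2 * a ≤ toℕ x × toℕ x < 2 * (a + 2 ^ j)

  inBlock? : ∀ j a x → Dec (InBlock j a x)
  inBlock? j a x = (2 * a ≤? toℕ x) ×-dec (toℕ x <? 2 * (a + 2 ^ j))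

  Half : ℕ → ℕ → Bool → Fin n → Set
  Half j a false = InBlock j a
  Half j a true  = InBlock j (a + 2 ^ j)

  block-end : ∀ j a → a + 2 ^ suc j ≡ a + 2 ^ j + 2 ^ j
  block-end j a = trans (cong (λ z → a + (2 ^ j + z)) (ℕ.+-identityʳ _)) (≡.sym (ℕ.+-assoc a _ _))

  lower⊆ : ∀ {j a x} → InBlock j a x → InBlock (suc j) a x
  lower⊆ {j} {a} (≤x , x<) = ≤x , ℕ.<-≤-trans x< (ℕ.*-monoʳ-≤ 2
    (subst (a + 2 ^ j ≤_) (≡.sym (block-end j a)) (ℕ.m≤m+n _ _)))

  upper⊆ : ∀ {j a x} → InBlock j (a + 2 ^ j) x → InBlock (suc j) a x
  upper⊆ {j} {a} {x} (≤x , x<) = ℕ.≤-trans (ℕ.*-monoʳ-≤ 2 (ℕ.m≤m+n a _)) ≤x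
    , subst (λ z → toℕ x < 2 * z) (≡.sym (block-end j a)) x<

  half⊆ : ∀ {j a} c {x} → Half j a c x → InBlock (suc j) a x
  half⊆ {j} {a} false = lower⊆ {j} {a}
  half⊆ {j} {a} true  = upper⊆ {j} {a}

  disjoint : ∀ {j a c x} → Half j a c x → ¬ Half j a (not c) x
  disjoint {c = false} (_ , x<) (≤x , _) = ℕ.<⇒≱ x< ≤x
  disjoint {c = true}  (≤x , _) (_ , x<) = ℕ.<⇒≱ x< ≤x

  module Block (j a : ℕ) (p : Fin n) = ChainAlternation (Half j a) p (λ {c} {x} → disjoint {j} {a} {c} {x})
  module AltIn (j a : ℕ) (p : Fin n) = Alternation (Half j a) p (λ {c} {x} → disjoint {j} {a} {c} {x})

  -- s is the total length of alternating chains, one for every block below (j , a).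
  -- The vertex p is odd so that it can outlive all even vertices.
  data Potential (T : Tubes) : ℕ → ℕ → ℕ → Set where
    leaf : ∀ {a} → Potential T 0 a 0
    fork : ∀ {j a s s₁ s₂} p → toℕ p ≡ suc (2 * a) → AltIn.Alt j a p T true ⊤ s →
           Potential T j (a + 2 ^ j) s₁ → Potential T j a s₂ → Potential T (suc j) a (s + (s₁ + s₂))

  ⊤-closed : ∀ j a p {T} → AltIn.ClosedIn j a p T ⊤
  ⊤-closed j a p _ _ _ = ∈⊤

  wide-block : ∀ j a → 2 + 2 * a ≤ 2 * (a + 2 ^ j)
  wide-block j a = subst (_≤ 2 * (a + 2 ^ j)) (ℕ.*-suc 2 a)
    (ℕ.*-monoʳ-≤ 2 (subst (_≤ a + 2 ^ j) (ℕ.+-comm a 1) (ℕ.+-monoʳ-≤ a (ℕ.m^n>0 2 j))))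

  module _ {T T′ : Tubes} (F : TreeFacts ⊤ T) (E : Exchange T T′) where
    open Exchange E

    -- If `u` is outside the block, `slide` applies vacuously. If `u` is inside and `v` outside,
    -- `shelter` applies: `t′` contains `u`, so convexity of the block keeps `p` in it.
    preserve : ∀ {j a s} → ¬ (InBlock j a u × InBlock j a v) → Potential T j a s → Potential T′ j a s
    preserve _ leaf = leaf
    preserve {suc j} {a} not-both (fork {s = s} p p≡ alt up low) =
      fork p p≡ alt′ (preserve (λ (hu , hv) → not-both (upper⊆ {j} {a} hu , upper⊆ {j} {a} hv)) up)
                     (preserve (λ (hu , hv) → not-both (lower⊆ {j} {a} hu , lower⊆ {j} {a} hv)) low)
      where
      open AltIn j a p
      p∈I : InBlock (suc j) a p
      p∈I = subst (2 * a ≤_) (≡.sym p≡) (ℕ.n≤1+n _)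
          , subst (_< 2 * (a + 2 ^ suc j)) (≡.sym p≡) (wide-block (suc j) a)
      alt′ : Alt T′ true ⊤ s
      alt′ with inBlock? (suc j) a u
      ... | no u∉  = slide F E (λ {c} _ hu → ⊥-elim (u∉ (half⊆ {j} {a} c hu))) (⊤-closed j a p) id alt
      ... | yes u∈ = shelter F E (λ {c} hv → v∉ (half⊆ {j} {a} c hv))
        (λ _ p∈P → interval-convex (wide-block (suc j) a) t′-child (tube-connected conn F (tube P-old))
                     v∉ u∈ p∈I (inside t-new) p∈P)
        (λ _ _ _ → id) alt
        where v∉ = λ v∈ → not-both (u∈ , v∈)

    -- Only the block that separates u from v loses anything.
    lose-two : ∀ {j a s} → Potential T j a s → ∃ λ s′ → Potential T′ j a s′ × s ≤ 2 + s′
    lose-two leaf = 0 , leaf , z≤n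
    lose-two {suc j} {a} (fork {s = s} {s₁} {s₂} p p≡ alt up low)
      with inBlock? j (a + 2 ^ j) u ×-dec inBlock? j (a + 2 ^ j) v | inBlock? j a u ×-dec inBlock? j a v
    -- When `u` and `v` share a half, the pattern of this block does not change; the loss occurs
    -- inside that half, and the other half contains neither vertex.
    ... | yes (hu , hv) | _ =
      let (s′ , up′ , s₁≤) = lose-two up
      in _ , fork p p≡ (slide F E (λ { {true} _ _ → hv ; {false} _ hu′ → ⊥-elim (disjoint {j} {a} {true} {u} hu hu′) })
                         (⊤-closed j a p) id alt)
              up′ (preserve (λ (hu′ , _) → disjoint {j} {a} {true} {u} hu hu′) low)
           , subst (s + (s₁ + s₂) ≤_) (eq s s′ s₂) (ℕ.+-monoʳ-≤ s (ℕ.+-monoˡ-≤ s₂ s₁≤))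
      where
      open AltIn j a p
      open +-*-Solver
      eq : ∀ x y z → x + (2 + y + z) ≡ 2 + (x + (y + z))
      eq = solve 3 (λ x y z → x :+ (con 2 :+ y :+ z) := con 2 :+ (x :+ (y :+ z))) refl
    ... | no _ | yes (hu , hv) =
      let (s′ , low′ , s₂≤) = lose-two low
      in _ , fork p p≡ (slide F E (λ { {false} _ _ → hv ; {true} _ hu′ → ⊥-elim (disjoint {j} {a} {true} {u} hu′ hu) })
                         (⊤-closed j a p) id alt)
              (preserve (λ (hu′ , _) → disjoint {j} {a} {true} {u} hu′ hu) up) low′
           , subst (s + (s₁ + s₂) ≤_) (eq s s₁ s′) (ℕ.+-monoʳ-≤ s (ℕ.+-monoʳ-≤ s₁ s₂≤))
      where
      open AltIn j a p
      open +-*-Solver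
      eq : ∀ x y z → x + (y + (2 + z)) ≡ 2 + (x + (y + z))
      eq = solve 3 (λ x y z → x :+ (y :+ (con 2 :+ z)) := con 2 :+ (x :+ (y :+ z))) refl
    -- When no half contains both vertices, the loss of two is charged to this block, and both
    -- halves are preserved.
    ... | no not-up | no not-low =
      let (s′ , alt′ , s≤) = shorten F E (⊤-closed j a p) alt
      in _ , fork p p≡ alt′ (preserve not-up up) (preserve not-low low)
           , ℕ.+-monoˡ-≤ (s₁ + s₂) s≤
      where open AltIn j a p

  Sorted : Tubes → Set
  Sorted T = ∀ x → ∃ λ U → U ∈ˡ T × x ∈ U × (∀ {y} → y ∈ U → toℕ x ≤ toℕ y)

  -- A nonempty chain starts with a root `r` in the upper half whose tube contains `p`. Some tube
  -- around `r` has no vertex below `r`, and by leastness it contains `p`; but `p` is in the lower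
  -- half. This is why chains in `Potential` start with `true`.
  sorted-potential : ∀ {T j a s} → Sorted T → Potential T j a s → s ≡ 0
  sorted-potential _ leaf = refl
  sorted-potential sorted (fork p p≡ AltIn.[] up low)
    rewrite sorted-potential sorted up | sorted-potential sorted low = refl
  sorted-potential {j = suc j} {a} sorted (fork p p≡ (AltIn._∷⟨_⟩_ {r = r} ρ (_ , p∈S , (mid≤r , _)) _) _ _) =
    let (U , U∈ , r∈U , r≤) = sorted r
    in contradiction (ℕ.≤-trans (wide-block j a) (ℕ.≤-trans mid≤r (subst (toℕ r ≤_) p≡ (r≤ (least ρ U∈ r∈U p∈S)))))
         (ℕ.<⇒≱ ℕ.≤-refl)

  potential≤ : ∀ {T T₂ s j a ℓ} → SearchTree (Square n) T → Sorted T₂ → Potential T j a s →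
               RotWalk (Square n) T T₂ ℓ → s ≤ ℓ * 2
  potential≤ _ sorted pot (done same) =
    ℕ.≤-reflexive (sorted-potential (λ x → let (U , U∈ , rest) = sorted x
                                           in U , Equivalence.from (same U) U∈ , rest) pot)
  potential≤ st sorted pot (step st′ rot walk) =
    let F = tree st
        (s′ , pot′ , s≤) = lose-two F (exchange conn F (tree st′) rot) pot
    in ℕ.≤-trans s≤ (ℕ.+-monoʳ-≤ 2 (potential≤ st′ sorted pot′ walk))

-- The bit-reversal tree and the increasing tree.

module BitReversal (J : ℕ) where

  N n : ℕ
  N = 2 ^ J
  n = 2 ^ suc J

  open SearchTrees (Square n)

  -- Taking residues makes the map total, so lists of vertices can be built without carrying bounds.
  vertex : ℕ → Fin n
  vertex i = _mod_ i n {{ℕ.m^n≢0 2 (suc J)}}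

  toℕ-vertex : ∀ {i} → i < n → toℕ (vertex i) ≡ i
  toℕ-vertex {i} i<n = trans (toℕ-fromℕ< (m%n<n i n {{ℕ.m^n≢0 2 (suc J)}}))
                             (m<n⇒m%n≡m {{ℕ.m^n≢0 2 (suc J)}} i<n)

  vertex-toℕ : ∀ x → vertex (toℕ x) ≡ x
  vertex-toℕ x = toℕ-injective (toℕ-vertex (toℕ<n x))

  even odd : ℕ → Fin n
  even i = vertex (2 * i)
  odd i  = vertex (suc (2 * i))

  toℕ-even : ∀ {i} → i < N → toℕ (even i) ≡ 2 * i
  toℕ-even i<N = toℕ-vertex (ℕ.*-monoʳ-< 2 i<N)

  toℕ-odd : ∀ {i} → i < N → toℕ (odd i) ≡ suc (2 * i)
  toℕ-odd {i} i<N = toℕ-vertex (subst (_≤ n) (ℕ.*-suc 2 i) (ℕ.*-monoʳ-≤ 2 i<N))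

  even≢odd : ∀ {i k} → i < N → k < N → even i ≢ odd k
  even≢odd {i} {k} i<N k<N eq = ℕ.even≢odd i k
    (trans (≡.sym (toℕ-even i<N)) (trans (cong toℕ eq) (toℕ-odd k<N)))

  close : ∀ {x y d} → toℕ y ≡ suc d + toℕ x → suc d ≤ 2 → Adj (Square n) x y
  close {x} {y} {d} eq d≤ =
    (λ { refl → ℕ.<⇒≢ (s≤s (ℕ.m≤n+m (toℕ x) d)) eq })
    , ℕ.≤-trans (subst (toℕ x ≤_) (≡.sym eq) (ℕ.m≤n+m (toℕ x) (suc d))) (ℕ.m≤n+m _ 2)
    , subst (_≤ 2 + toℕ x) (≡.sym eq) (ℕ.+-monoˡ-≤ (toℕ x) d≤)

  increasing : List (Fin n)
  increasing = run vertex n 0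

  2^-suc : ∀ k → ∃ λ m → 2 ^ k ≡ suc m
  2^-suc k with 2 ^ k | ℕ.m^n>0 2 k
  ... | suc m | _ = m , refl

  increasing-elim : Elim increasing
  increasing-elim = subst (λ k → Elim (run vertex k 0)) (≡.sym (proj₂ (2^-suc (suc J))))
    (run-elim (Square n) vertex (proj₁ (2^-suc (suc J))) λ {i} i< →
      let i<n = subst (suc (suc i) ≤_) (≡.sym (proj₂ (2^-suc (suc J)))) i<
      in close (trans (toℕ-vertex i<n) (cong suc (≡.sym (toℕ-vertex (ℕ.<⇒≤ i<n))))) (s≤s z≤n))

  increasing-sorted : AllPairs (λ x y → toℕ x < toℕ y) increasing
  increasing-sorted = run-AllPairs vertex n λ i<j j<n →
    ≡.subst₂ _<_ (≡.sym (toℕ-vertex (ℕ.<-trans i<j j<n))) (≡.sym (toℕ-vertex j<n)) i<j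

  increasing-all : Enumerates increasing ⊤
  increasing-all = enumerates
    (λ {x} _ → subst (_∈ₗ increasing) (vertex-toℕ x) (∈-run⁺ vertex n z≤n (toℕ<n x)))
    (λ _ → ∈⊤)
    (AllPairs.map (λ { x<y refl → ℕ.<-irrefl refl x<y }) increasing-sorted)

  square-connected : Connected (Square n)
  square-connected = elim-connected increasing-elim increasing-all

  open DyadicPotential square-connected

  -- Bit-reversal order of the even vertices 2i with a ≤ i < a + 2 ^ j.
  bitRev : ℕ → ℕ → List (Fin n)
  bitRev zero    a = even a ∷ []
  bitRev (suc j) a = interleave (bitRev j (a + 2 ^ j)) (bitRev j a)

  bitRev-↭ : ∀ j a → bitRev (suc j) a ↭ bitRev j (a + 2 ^ j) ++ bitRev j a
  bitRev-↭ j a = interleave-↭ (bitRev j (a + 2 ^ j)) (bitRev j a)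

  length-bitRev : ∀ j a → length (bitRev j a) ≡ 2 ^ j
  length-bitRev zero    a = refl
  length-bitRev (suc j) a = begin
    length (bitRev (suc j) a)
      ≡⟨ ↭-length (bitRev-↭ j a) ⟩
    length (bitRev j (a + 2 ^ j) ++ bitRev j a)
      ≡⟨ length-++ (bitRev j (a + 2 ^ j)) ⟩
    length (bitRev j (a + 2 ^ j)) + length (bitRev j a)
      ≡⟨ ≡.cong₂ _+_ (length-bitRev j (a + 2 ^ j)) (length-bitRev j a) ⟩
    2 ^ j + 2 ^ j
      ≡⟨ cong (2 ^ j +_) (ℕ.+-identityʳ _) ⟨
    2 ^ suc j ∎
    where open ≡.≡-Reasoning

  lower-fits : ∀ j a → a + 2 ^ suc j ≤ N → a + 2 ^ j ≤ N
  lower-fits j a = ℕ.≤-trans (ℕ.+-monoʳ-≤ a (ℕ.m≤m+n _ _))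

  upper-fits : ∀ j a → a + 2 ^ suc j ≤ N → a + 2 ^ j + 2 ^ j ≤ N
  upper-fits j a = subst (_≤ N) (block-end j a)

  bitRev-even : ∀ j a → a + 2 ^ j ≤ N →
                All (λ x → ∃ λ i → a ≤ i × i < a + 2 ^ j × x ≡ even i) (bitRev j a)
  bitRev-even zero    a _ = (a , ℕ.≤-refl , ℕ.m<m+n a (s≤s z≤n) , refl) ∷ []
  bitRev-even (suc j) a fits = All-resp-↭ (↭-sym (bitRev-↭ j a)) (Allₚ.++⁺
    (All.map (λ (i , a≤ , i< , eq) → i , ℕ.≤-trans (ℕ.m≤m+n a _) a≤ , subst (i <_) (≡.sym (block-end j a)) i< , eq)
      (bitRev-even j (a + 2 ^ j) (upper-fits j a fits)))
    (All.map (λ (i , a≤ , i< , eq) → i , a≤ , ℕ.<-≤-trans i< (ℕ.+-monoʳ-≤ a (ℕ.m≤m+n _ _)) , eq)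
      (bitRev-even j a (lower-fits j a fits))))

  bitRev-block : ∀ j a → a + 2 ^ j ≤ N → All (InBlock j a) (bitRev j a)
  bitRev-block j a fits = All.map inside (bitRev-even j a fits)
    where
    inside : ∀ {x} → (∃ λ i → a ≤ i × i < a + 2 ^ j × x ≡ even i) → InBlock j a x
    inside (i , a≤i , i< , refl) rewrite toℕ-even (ℕ.<-≤-trans i< fits) =
      ℕ.*-monoʳ-≤ 2 a≤i , ℕ.*-monoʳ-< 2 i<

  ∈-bitRev : ∀ j a {i} → a ≤ i → i < a + 2 ^ j → even i ∈ₗ bitRev j a
  ∈-bitRev zero    a {i} a≤i i<
    with refl ← ℕ.≤-antisym a≤i (ℕ.≤-pred (subst (i <_) (ℕ.+-comm a 1) i<)) = here refl
  ∈-bitRev (suc j) a {i} a≤i i< = ∈-resp-↭ (↭-sym (bitRev-↭ j a)) (in-half (ℕ.≤-<-connex (a + 2 ^ j) i))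
    where
    in-half : a + 2 ^ j ≤ i ⊎ i < a + 2 ^ j → even i ∈ₗ (bitRev j (a + 2 ^ j) ++ bitRev j a)
    in-half (inj₁ mid≤i) = ∈-++⁺ˡ (∈-bitRev j (a + 2 ^ j) mid≤i (subst (i <_) (block-end j a) i<))
    in-half (inj₂ i<mid) = ∈-++⁺ʳ _ (∈-bitRev j a a≤i i<mid)

  bitRev-unique : ∀ j a → a + 2 ^ j ≤ N → Unique (bitRev j a)
  bitRev-unique zero    a _    = [] ∷ []
  bitRev-unique (suc j) a fits =
    Unique-resp-↭ (≡.setoid (Fin n)) (↭⇒↭ₛ (↭-sym (bitRev-↭ j a)))
      (Uniqueₚ.++⁺ (bitRev-unique j (a + 2 ^ j) (upper-fits j a fits)) (bitRev-unique j a (lower-fits j a fits))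
        λ {x} (x∈up , x∈low) → disjoint {j} {a} {true} {x}
          (All.lookup (bitRev-block j (a + 2 ^ j) (upper-fits j a fits)) x∈up)
          (All.lookup (bitRev-block j a (lower-fits j a fits)) x∈low))

  evens odds : List (Fin n)
  evens = bitRev J 0
  odds  = run odd N 0

  odds-elim : Elim odds
  odds-elim = subst (λ k → Elim (run odd k 0)) (≡.sym (proj₂ (2^-suc J)))
    (run-elim (Square n) odd (proj₁ (2^-suc J)) λ {i} i< →
    let i<N = subst (suc (suc i) ≤_) (≡.sym (proj₂ (2^-suc J))) i<
    in close (trans (toℕ-odd i<N)
               (trans (cong suc (ℕ.*-suc 2 i)) (cong (2 +_) (≡.sym (toℕ-odd (ℕ.<⇒≤ i<N)))))) ℕ.≤-refl)

  alternating-elim : Elim (evens ++ odds)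
  alternating-elim = ++-elim (Square n)
    (All.map (λ { (i , _ , i<N , refl) → lose (∈-run⁺ odd N z≤n i<N)
                   (close (trans (toℕ-odd i<N) (cong suc (≡.sym (toℕ-even i<N)))) (s≤s z≤n)) })
      (bitRev-even J 0 ℕ.≤-refl))
    odds-elim

  alternating-all : Enumerates (evens ++ odds) ⊤
  alternating-all = enumerates (λ {x} _ → found x) (λ _ → ∈⊤)
    (Uniqueₚ.++⁺ (bitRev-unique J 0 ℕ.≤-refl)
      (run-AllPairs odd N λ {i} {k} i<k k<N eq → ℕ.<⇒≢ i<k
        (ℕ.*-cancelˡ-≡ i k 2 (ℕ.suc-injective
          (trans (≡.sym (toℕ-odd (ℕ.<-trans i<k k<N))) (trans (cong toℕ eq) (toℕ-odd k<N))))))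
      λ (x∈evens , x∈odds) →
        let (_ , _ , i<N , x≡even) = All.lookup (bitRev-even J 0 ℕ.≤-refl) x∈evens
            (_ , _ , k<N , x≡odd)  = ∈-run⁻ odd N x∈odds
        in even≢odd i<N k<N (trans (≡.sym x≡even) x≡odd))
    where
    found : ∀ x → x ∈ₗ (evens ++ odds)
    found x with parity (toℕ x)
    ... | i , inj₁ eq = subst (_∈ₗ (evens ++ odds)) (trans (cong vertex (≡.sym eq)) (vertex-toℕ x))
      (∈-++⁺ˡ (∈-bitRev J 0 z≤n (ℕ.*-cancelˡ-< 2 i N (subst (_< n) eq (toℕ<n x)))))
    ... | i , inj₂ eq = subst (_∈ₗ (evens ++ odds)) (trans (cong vertex (≡.sym eq)) (vertex-toℕ x))
      (∈-++⁺ʳ evens (∈-run⁺ odd N z≤n (ℕ.*-cancelˡ-< 2 i N (ℕ.<-trans (ℕ.n<1+n _) (subst (_< n) eq (toℕ<n x))))))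

  T₁ T₂ : Tubes
  T₁ = chain ⊤ (evens ++ odds)
  T₂ = chain ⊤ increasing

  T₂-sorted : Sorted T₂
  T₂-sorted x = chain-sorted increasing-all increasing-sorted (Enumerates.to increasing-all ∈⊤)

  module _ (j a : ℕ) (p : Fin n) where
    open Block j a p

    not-not : ∀ c {xs} → All (Half j a c) xs → All (Half j a (not (not c))) xs
    not-not c {xs} = subst (λ d → All (Half j a d) xs) (≡.sym (Bool.not-involutive c))

    mutual
      -- The two lists swap roles after every element, so equal lengths give way to lengths
      -- differing by one, and back.
      alternates : ∀ {c} xs ys → length xs ≡ length ys → All (Half j a c) xs →
                   All (Half j a (not c)) ys → Alternates c (interleave xs ys)
      alternates     []       []   _  _         _  = []
      alternates {c} (x ∷ xs) ys   eq (hx ∷ hs) h′ = hx ∷ alternates⁺ ys xs (≡.sym eq) h′ (not-not c hs)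

      alternates⁺ : ∀ {c} xs ys → length xs ≡ suc (length ys) → All (Half j a c) xs →
                    All (Half j a (not c)) ys → Alternates c (interleave xs ys)
      alternates⁺ {c} (x ∷ xs) ys eq (hx ∷ hs) h′ =
        hx ∷ alternates ys xs (≡.sym (ℕ.suc-injective eq)) h′ (not-not c hs)

    bitRev-alternates : a + 2 ^ suc j ≤ N → Alternates true (bitRev (suc j) a)
    bitRev-alternates fits = alternates (bitRev j (a + 2 ^ j)) (bitRev j a)
      (trans (length-bitRev j (a + 2 ^ j)) (≡.sym (length-bitRev j a)))
      (bitRev-block j (a + 2 ^ j) (upper-fits j a fits))
      (bitRev-block j a (lower-fits j a fits))

  -- A block of `2 ^ i` pairs with `i ≥ 1` contributes one entry per even vertex. Each of the `j`
  -- levels thus contributes `2 ^ j` in all. The choice `odd a` for `p` outlives every even vertex.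
  T₁-potential : ∀ j a → a + 2 ^ j ≤ N → bitRev j a ⊑ evens → Potential T₁ j a (j * 2 ^ j)
  T₁-potential zero    a _    _   = leaf
  T₁-potential (suc j) a fits sub = subst (Potential T₁ (suc j) a) total
    (fork (odd a) (toℕ-odd a<N)
      (chain-alt alternating-all (∈-run⁺ odd N z≤n a<N) inj₁ id id sub (bitRev-alternates j a (odd a) fits))
      (T₁-potential j (a + 2 ^ j) (upper-fits j a fits) (⊆-trans (⊑-interleaveˡ up low) sub))
      (T₁-potential j a (lower-fits j a fits) (⊆-trans (⊑-interleaveʳ up low) sub)))
    where
    open Block j a (odd a) using (chain-alt)
    up low : List (Fin n)
    up  = bitRev j (a + 2 ^ j)
    low = bitRev j a
    a<N : a < N
    a<N = ℕ.<-≤-trans (ℕ.m<m+n a (ℕ.m^n>0 2 (suc j))) fits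
    open +-*-Solver
    count : ∀ x y → 2 * x + (y * x + y * x) ≡ (1 + y) * (2 * x)
    count = solve 2 (λ x y → con 2 :* x :+ (y :* x :+ y :* x) := (con 1 :+ y) :* (con 2 :* x)) refl
    total : length (bitRev (suc j) a) + (j * 2 ^ j + j * 2 ^ j) ≡ suc j * 2 ^ suc j
    total = trans (cong (_+ (j * 2 ^ j + j * 2 ^ j)) (length-bitRev (suc j) a)) (count (2 ^ j) j)

  rotations≥ : ∀ {ℓ} → RotWalk (Square n) T₁ T₂ ℓ → J * N ≤ ℓ * 2
  rotations≥ = potential≤ (elim-tree alternating-elim alternating-all) T₂-sorted
    (T₁-potential J 0 ℕ.≤-refl ⊆-refl)

  square-pathwidth : 1 ≤ J → PathwidthTwo (Square n)
  square-pathwidth 1≤J = square-width≤2 n ,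
    triangle-width>1 (Square n) (proj₁ 0~1) (proj₁ 1~2) (proj₁ 0~2) 0~1 1~2 0~2
    where
    2<n : 2 < n
    2<n = ℕ.≤-trans (s≤s (s≤s (s≤s z≤n))) (ℕ.^-monoʳ-≤ 2 (s≤s 1≤J))
    at : ∀ {i} → i ≤ 2 → toℕ (vertex i) ≡ i
    at i≤2 = toℕ-vertex (ℕ.≤-<-trans i≤2 2<n)
    0~1 : Adj (Square n) (vertex 0) (vertex 1)
    0~1 = close (trans (at (s≤s z≤n)) (cong suc (≡.sym (at z≤n)))) (s≤s z≤n)
    1~2 : Adj (Square n) (vertex 1) (vertex 2)
    1~2 = close (trans (at ℕ.≤-refl) (cong suc (≡.sym (at (s≤s z≤n))))) (s≤s z≤n)
    0~2 : Adj (Square n) (vertex 0) (vertex 2)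
    0~2 = close (trans (at ℕ.≤-refl) (cong (2 +_) (≡.sym (at z≤n)))) ℕ.≤-refl

-- The final count.

n-log-n-bound : ∀ J ℓ → 1 ≤ J → J * 2 ^ J ≤ ℓ * 2 → 2 ^ suc J * suc J ≤ 8 * ℓ
n-log-n-bound J ℓ 1≤J le = begin
  -- The constant 8 collects three factors of two: two vertices per pair, `J + 1 ≤ 2 J`, and a loss
  -- of at most two per rotation.
  2 ^ suc J * suc J      ≤⟨ ℕ.*-monoʳ-≤ (2 ^ suc J) (ℕ.+-monoˡ-≤ J 1≤J) ⟩
  2 * 2 ^ J * (J + J)    ≡⟨ solve 2 (λ x y → con 2 :* x :* (y :+ y) := con 4 :* (y :* x)) refl (2 ^ J) J ⟩
  4 * (J * 2 ^ J)        ≤⟨ ℕ.*-monoʳ-≤ 4 le ⟩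
  4 * (ℓ * 2)            ≡⟨ solve 1 (λ x → con 4 :* (x :* con 2) := con 8 :* x) refl ℓ ⟩
  8 * ℓ                  ∎
  where
  open ℕ.≤-Reasoning
  open +-*-Solver

theorem20 : Σ ℕ λ d → 1 ≤ d × ((k : ℕ) → 2 ≤ k →
    Σ (Graph (2 ^ k)) λ G → Connected G × PathwidthTwo G ×
    Σ (List (Subset (2 ^ k))) λ T₁ → Σ (List (Subset (2 ^ k))) λ T₂ →
    SearchTree G T₁ × SearchTree G T₂ ×
    ((ℓ : ℕ) → RotWalk G T₁ T₂ ℓ → (2 ^ k) * k ≤ d * ℓ))
theorem20 = 8 , s≤s z≤n , λ where
  (suc J) (s≤s 1≤J) → let open BitReversal J in
    Square n , square-connected , square-pathwidth 1≤J , T₁ , T₂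
    , SearchTrees.elim-tree (Square n) alternating-elim alternating-all
    , SearchTrees.elim-tree (Square n) increasing-elim increasing-all
    , λ ℓ walk → n-log-n-bound J ℓ 1≤J (rotations≥ walk)
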